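{- For any odd positive integer $k$, \[\{G\mid c_2(G)\leq k\}=\{G\mid \mathrm{mr}(G,\mathbb{F}_2)\leq k\},\] where $G$ ranges over all finite simple graphs.
   Context: All graphs are finite and simple. A subgraph complementation system for a graph $G=(V,E)$ is a finite collection (family) $\mathscr{C}$ of subsets of $V$ such that, for any two distinct vertices $u,v\in V$, $uv\in E$ if and only if $u$ and $v$ appear together in an odd number of sets in $\mathscr{C}$. The subgraph complementation number $c_2(G)$ is the minimum cardinality of a subgraph complementation system for $G$. A symmetric matrix over a field $\mathbb{F}$ with rows and columns indexed by $V$ fits $G$ if, for distinct $u,v$, its $(u,v)$ entry is nonzero if and only if $uv\in E$ (the diagonal is arbitrary). $\mathrm{mr}(G,\mathbb{F})$ is the minimum rank over $\mathbb{F}$ of a symmetric matrix over $\mathbb{F}$ which fits $G$. -}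

module Defs where

open import Algebra.Bundles using (CommutativeRing)
import Algebra.Definitions.RawMonoid as RawMonoidDefs
open import Data.Fin.Base using (Fin; zero; suc)
import Data.Fin.Properties as Fin
open import Data.Fin.Subset using (Subset; inside; outside; _∈_; _∉_; ∣_∣; ⊥)
open import Data.Fin.Subset.Properties
  using (_∈?_; anySubset?; ∣p∣≤n; ∣⊥∣≡0; ∉⊥)
open import Data.Nat.Base using (ℕ; zero; suc; _≤_; z≤n; s≤s; parity)
import Data.Nat.Properties as ℕ
open import Data.Parity.Base using (Parity; 0ℙ; 1ℙ)
import Data.Parity.Properties as ℙ
open import Data.Product.Base using (Σ; ∃; _×_; _,_; proj₁; proj₂)
open import Data.Vec.Base using (Vec; []; _∷_; count; lookup; map; tabulate)
open import Data.Vec.Properties using (lookup∘tabulate; lookup⇒[]=; []=⇒lookup)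
open import Function.Base using (_∘_)
open import Function.Bundles using (_⇔_; mk⇔; Equivalence)
open import Level using (0ℓ)
open import Relation.Binary.Core using (Rel)
open import Relation.Binary.Definitions using (Symmetric; Irreflexive)
import Relation.Binary.Definitions as Binary
open import Relation.Binary.PropositionalEquality
  using (_≡_; _≢_; refl; sym; trans; cong; subst)
open import Relation.Nullary using (Dec; yes; no; does; contradiction)
open import Relation.Nullary.Decidable
  using (map′; ¬?; _×-dec_; _→-dec_; decidable-stable; dec-true)
open import Relation.Unary using (Pred; Decidable)

Odd : ℕ → Set
Odd n = parity n ≡ 1ℙ

IsLeast IsGreatest : Pred ℕ 0ℓ → ℕ → Set
IsLeast    P m = P m × (∀ j → P j → m ≤ j)
IsGreatest P m = P m × (∀ j → P j → j ≤ m)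

private
  least-below : ∀ {P : Pred ℕ 0ℓ} → Decidable P → ∀ m → P m → ∃ (IsLeast P)
  least-below P? m pm with P? 0
  least-below P? m       pm | yes p0 = 0 , p0 , λ _ _ → z≤n
  least-below P? zero    pm | no ¬p0 = contradiction pm ¬p0
  least-below {P} P? (suc m) pm | no ¬p0
    with k , pk , k≤ ← least-below (P? ∘ suc) m pm = suc k , pk , above
    where
    above : ∀ j → P j → suc k ≤ j
    above zero    p0 = contradiction p0 ¬p0
    above (suc j) pj = s≤s (k≤ j pj)

least : {P : Pred ℕ 0ℓ} → Decidable P → ∃ P → ∃ (IsLeast P)
least P? (m , pm) = least-below P? m pm

greatest : {P : Pred ℕ 0ℓ} → Decidable P → ∃ P →
           ∀ b → (∀ j → P j → j ≤ b) → ∃ (IsGreatest P)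
greatest P? ex b ≤b with P? b
greatest P? ex       b       ≤b | yes pb = b , pb , ≤b
greatest {P} P? (m , pm) zero    ≤b | no ¬pb =
  contradiction (subst P (ℕ.n≤0⇒n≡0 (≤b m pm)) pm) ¬pb
greatest {P} P? ex       (suc b) ≤b | no ¬pb = greatest P? ex b ≤b′
  where
  ≤b′ : ∀ j → P j → j ≤ b
  ≤b′ j pj = ℕ.≤-pred (ℕ.≤∧≢⇒< (≤b j pj) λ { refl → ¬pb pj })

-- Types over which existential statements can be decided by exhaustive
-- search; this is what makes the minima and maxima below computable.
Searchable : Set → Set₁
Searchable A = {P : Pred A 0ℓ} → Decidable P → Dec (∃ P)

searchVec : ∀ {A} → Searchable A → ∀ n → Searchable (Vec A n)
searchVec search zero    P? =
  map′ (λ p → [] , p) (λ { ([] , p) → p }) (P? [])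
searchVec search (suc n) P? =
  map′ (λ (x , xs , p) → x ∷ xs , p) (λ { (x ∷ xs , p) → x , xs , p })
       (search λ x → searchVec search n λ xs → P? (x ∷ xs))

∀? : ∀ {A} → Searchable A → {P : Pred A 0ℓ} → Decidable P → Dec (∀ x → P x)
∀? search P? with search (¬? ∘ P?)
... | yes (x , ¬p) = no λ p → ¬p (p x)
... | no ¬∃¬       = yes λ x → decidable-stable (P? x)
                                 λ ¬p → ¬∃¬ (x , ¬p)

_⇔?_ : {A B : Set} → Dec A → Dec B → Dec (A ⇔ B)
A? ⇔? B? = map′ (λ (f , g) → mk⇔ f g)
                (λ e → Equivalence.to e , Equivalence.from e)
                ((A? →-dec B?) ×-dec (B? →-dec A?))

record Graph : Set₁ where
  field
    order    : ℕ
    _~_      : Rel (Fin order) 0ℓ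
    ~-sym    : Symmetric _~_
    ~-irrefl : Irreflexive _≡_ _~_
    _~?_     : Binary.Decidable _~_

  Vertex : Set
  Vertex = Fin order

open Graph using (order; Vertex)

timesTogether : ∀ {n k} → Vec (Subset n) k → Fin n → Fin n → ℕ
timesTogether 𝒞 u v = count (λ S → (u ∈? S) ×-dec (v ∈? S)) 𝒞

-- A system is a family, so a subset may be listed more than once; since two
-- equal members can be deleted, this does not affect the minimum size.
IsSystem : (G : Graph) → ∀ {k} → Vec (Subset (order G)) k → Set
IsSystem G 𝒞 = ∀ (u v : Vertex G) → u ≢ v → (u ~ v) ⇔ Odd (timesTogether 𝒞 u v)
  where open Graph G using (_~_)

HasSystemOfSize : Graph → ℕ → Set
HasSystemOfSize G k = Σ (Vec (Subset (order G)) k) (IsSystem G)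

hasSystemOfSize? : ∀ G → Decidable (HasSystemOfSize G)
hasSystemOfSize? G k = searchVec anySubset? k λ 𝒞 →
  Fin.all? λ u → Fin.all? λ v →
    ¬? (u Fin.≟ v) →-dec ((u ~? v) ⇔? (parity (timesTogether 𝒞 u v) ℙ.≟ 1ℙ))
  where open Graph G using (_~?_)

private
  -- Recursively, a system for G − v together with the two sets N[v] and N(v).
  systemExists : ∀ n (_~_ : Rel (Fin n) 0ℓ) (s : Symmetric _~_)
                 (i : Irreflexive _≡_ _~_) (d : Binary.Decidable _~_) →
                 ∃ (HasSystemOfSize record { _~_ = _~_ ; ~-sym = s ; ~-irrefl = i ; _~?_ = d })
  systemExists zero    _~_ s i d = 0 , [] , λ ()
  systemExists (suc n) _~_ s i d
    with k , 𝒞 , sys ← systemExists n (λ u v → suc u ~ suc v) s (λ { refl → i refl })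
                                    (λ u v → d (suc u) (suc v))
    = suc (suc k) , 𝒞⁺ , sys⁺
    where
    N : Subset n
    N = tabulate λ b → does (d zero (suc b))

    𝒞⁺ : Vec (Subset (suc n)) (suc (suc k))
    𝒞⁺ = (inside ∷ N) ∷ (outside ∷ N) ∷ map (outside ∷_) 𝒞

    lower : ∀ {k} (𝒟 : Vec (Subset n) k) a b →
            timesTogether (map (outside ∷_) 𝒟) (suc a) (suc b) ≡ timesTogether 𝒟 a b
    lower []      a b = refl
    lower (S ∷ 𝒟) a b with a ∈? S | b ∈? S
    ... | yes _ | yes _ = cong suc (lower 𝒟 a b)
    ... | yes _ | no  _ = lower 𝒟 a b
    ... | no  _ | yes _ = lower 𝒟 a b
    ... | no  _ | no  _ = lower 𝒟 a b

    noneˡ : ∀ {k} (𝒟 : Vec (Subset n) k) b →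
            timesTogether (map (outside ∷_) 𝒟) zero (suc b) ≡ 0
    noneˡ []      b = refl
    noneˡ (S ∷ 𝒟) b with b ∈? S
    ... | yes _ = noneˡ 𝒟 b
    ... | no  _ = noneˡ 𝒟 b

    noneʳ : ∀ {k} (𝒟 : Vec (Subset n) k) b →
            timesTogether (map (outside ∷_) 𝒟) (suc b) zero ≡ 0
    noneʳ []      b = refl
    noneʳ (S ∷ 𝒟) b with b ∈? S
    ... | yes _ = noneʳ 𝒟 b
    ... | no  _ = noneʳ 𝒟 b

    ∈N⇒ : ∀ {b} → b ∈ N → zero ~ suc b
    ∈N⇒ {b} b∈N with d zero (suc b) | trans (sym (lookup∘tabulate (λ b → does (d zero (suc b))) b)) ([]=⇒lookup b∈N)
    ... | yes e | _  = e
    ... | no  _ | ()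

    ⇒∈N : ∀ {b} → zero ~ suc b → b ∈ N
    ⇒∈N {b} e = lookup⇒[]= b N (trans (lookup∘tabulate _ b) (dec-true (d zero (suc b)) e))

    sys⁺ : ∀ u v → u ≢ v → (u ~ v) ⇔ Odd (timesTogether 𝒞⁺ u v)
    sys⁺ zero    zero    u≢v = contradiction refl u≢v
    sys⁺ zero    (suc b) u≢v with b ∈? N
    ... | yes b∈N rewrite noneˡ 𝒞 b = mk⇔ (λ _ → refl) (λ _ → ∈N⇒ b∈N)
    ... | no  b∉N rewrite noneˡ 𝒞 b = mk⇔ (λ e → contradiction (⇒∈N e) b∉N) (λ ())
    sys⁺ (suc a) zero    u≢v with a ∈? N
    ... | yes a∈N rewrite noneʳ 𝒞 a = mk⇔ (λ _ → refl) (λ _ → s (∈N⇒ a∈N))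
    ... | no  a∉N rewrite noneʳ 𝒞 a = mk⇔ (λ e → contradiction (⇒∈N (s e)) a∉N) (λ ())
    sys⁺ (suc a) (suc b) u≢v with a ∈? N | b ∈? N
    ... | yes _ | yes _ rewrite lower 𝒞 a b = sys a b (u≢v ∘ cong suc)
    ... | yes _ | no  _ rewrite lower 𝒞 a b = sys a b (u≢v ∘ cong suc)
    ... | no  _ | yes _ rewrite lower 𝒞 a b = sys a b (u≢v ∘ cong suc)
    ... | no  _ | no  _ rewrite lower 𝒞 a b = sys a b (u≢v ∘ cong suc)

c₂-least : ∀ G → ∃ (IsLeast (HasSystemOfSize G))
c₂-least G = least (hasSystemOfSize? G) (systemExists (order G) _~_ ~-sym ~-irrefl _~?_)
  where open Graph G using (_~_; ~-sym; ~-irrefl; _~?_)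

c₂ : Graph → ℕ
c₂ G = proj₁ (c₂-least G)

-- Parity with its ring structure is ℤ/2ℤ.
𝔽₂ : Set
𝔽₂ = Parity

open CommutativeRing ℙ.+-*-commutativeRing using (+-rawMonoid; _*_)
open RawMonoidDefs +-rawMonoid using (sum)

search𝔽₂ : Searchable 𝔽₂
search𝔽₂ P? with P? 0ℙ | P? 1ℙ
... | yes p | _     = yes (0ℙ , p)
... | no _  | yes p = yes (1ℙ , p)
... | no ¬p | no ¬q = no λ { (0ℙ , p) → ¬p p ; (1ℙ , q) → ¬q q }

Matrix : ℕ → ℕ → Set
Matrix m n = Vec (Vec 𝔽₂ n) m

entry : ∀ {m n} → Matrix m n → Fin m → Fin n → 𝔽₂
entry M i j = lookup (lookup M i) j

IndependentColumns : ∀ {m n} → Matrix m n → Subset n → Set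
IndependentColumns {m} {n} M S = ∀ (c : Vec 𝔽₂ n) →
  (∀ j → j ∉ S → lookup c j ≡ 0ℙ) →
  (∀ (i : Fin m) → sum (λ j → lookup c j * entry M i j) ≡ 0ℙ) →
  ∀ j → lookup c j ≡ 0ℙ

HasIndependentColumns : ∀ {m n} → Matrix m n → ℕ → Set
HasIndependentColumns M r = ∃ λ S → ∣ S ∣ ≡ r × IndependentColumns M S

hasIndependentColumns? : ∀ {m n} (M : Matrix m n) → Decidable (HasIndependentColumns M)
hasIndependentColumns? {n = n} M r = anySubset? λ S → (∣ S ∣ ℕ.≟ r) ×-dec
  ∀? (searchVec search𝔽₂ n) λ c →
    (Fin.all? λ j → ¬? (j ∈? S) →-dec (lookup c j ℙ.≟ 0ℙ)) →-dec
    ((Fin.all? λ i → sum (λ j → lookup c j * entry M i j) ℙ.≟ 0ℙ) →-dec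
    (Fin.all? λ j → lookup c j ℙ.≟ 0ℙ))

rank-greatest : ∀ {m n} (M : Matrix m n) → ∃ (IsGreatest (HasIndependentColumns M))
rank-greatest {n = n} M = greatest (hasIndependentColumns? M)
  (0 , ⊥ , ∣⊥∣≡0 n , λ c c≡0 _ j → c≡0 j ∉⊥)
  n (λ { _ (S , refl , _) → ∣p∣≤n S })

rank : ∀ {m n} → Matrix m n → ℕ
rank M = proj₁ (rank-greatest M)

IsSymmetric : ∀ {n} → Matrix n n → Set
IsSymmetric M = ∀ i j → entry M i j ≡ entry M j i

Fits : (G : Graph) → Matrix (order G) (order G) → Set
Fits G M = IsSymmetric M ×
  (∀ (u v : Vertex G) → u ≢ v → (entry M u v ≢ 0ℙ) ⇔ (u ~ v))
  where open Graph G using (_~_)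

fits? : ∀ G → Decidable (Fits G)
fits? G M =
  (Fin.all? λ i → Fin.all? λ j → entry M i j ℙ.≟ entry M j i) ×-dec
  (Fin.all? λ u → Fin.all? λ v →
    ¬? (u Fin.≟ v) →-dec (¬? (entry M u v ℙ.≟ 0ℙ) ⇔? (u ~? v)))
  where open Graph G using (_~?_)

FitsWithRank : Graph → ℕ → Set
FitsWithRank G r = ∃ λ M → Fits G M × rank M ≡ r

fitsWithRank? : ∀ G → Decidable (FitsWithRank G)
fitsWithRank? G r = searchVec (searchVec search𝔽₂ (order G)) (order G) λ M →
  fits? G M ×-dec (rank M ℕ.≟ r)

private
  fittingMatrix : ∀ G → ∃ (Fits G)
  fittingMatrix G = A , symA , fitsA
    where
    open Graph G using (_~_; ~-sym; _~?_)

    a : ∀ u v → 𝔽₂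
    a u v with u ~? v
    ... | yes _ = 1ℙ
    ... | no  _ = 0ℙ

    A : Matrix (order G) (order G)
    A = tabulate λ u → tabulate (a u)

    A≡a : ∀ u v → entry A u v ≡ a u v
    A≡a u v = trans (cong (λ row → lookup row v) (lookup∘tabulate (λ u → tabulate (a u)) u))
                    (lookup∘tabulate (a u) v)

    a-sym : ∀ u v → a u v ≡ a v u
    a-sym u v with u ~? v | v ~? u
    ... | yes _ | yes _ = refl
    ... | yes e | no ¬e = contradiction (~-sym e) ¬e
    ... | no ¬e | yes e = contradiction (~-sym e) ¬e
    ... | no  _ | no  _ = refl

    symA : IsSymmetric A
    symA u v = trans (A≡a u v) (trans (a-sym u v) (sym (A≡a v u)))

    fitsA : ∀ u v → u ≢ v → (entry A u v ≢ 0ℙ) ⇔ (u ~ v)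
    fitsA u v _ rewrite A≡a u v with u ~? v
    ... | yes e = mk⇔ (λ _ → e) (λ _ ())
    ... | no ¬e = mk⇔ (λ 0≢0 → contradiction refl 0≢0) (λ e → contradiction e ¬e)

mr𝔽₂-least : ∀ G → ∃ (IsLeast (FitsWithRank G))
mr𝔽₂-least G with M , fits ← fittingMatrix G =
  least (fitsWithRank? G) (rank M , M , fits , refl)

mr𝔽₂ : Graph → ℕ
mr𝔽₂ G = proj₁ (mr𝔽₂-least G)

{-# OPTIONS --safe #-}

-- A system of k sets is the same as a Gram decomposition of a fitting matrix
-- as a sum of k squares a aᵀ over 𝔽₂, so c₂ bounds the rank.  Conversely, a
-- symmetric matrix of rank at most k is reduced by symmetric pivoting to a sum
-- of p squares and q hyperbolic terms a bᵀ + b aᵀ with p + 2 q ≤ k.  By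
--   c cᵀ + a bᵀ + b aᵀ
--     = (a+c)(a+c)ᵀ + (b+c)(b+c)ᵀ + (a+b+c)(a+b+c)ᵀ
-- a square absorbs a hyperbolic term at the cost of two further squares.  One
-- square is needed to start this: if p > 0 it is at hand, and if p = 0 then
-- 2 q ≤ k with k odd leaves room for the zero square.
module Submission where

open import Defs
open import Algebra.Bundles using (CommutativeRing)
import Algebra.Properties.Semiring.Sum as SemiringSum
import Algebra.Solver.Ring.AlmostCommutativeRing as ACR
import Algebra.Solver.Ring.Simple as RingSolver
open import Data.Fin.Base using (Fin; zero; suc)
import Data.Fin.Properties as Fin
open import Data.Fin.Subset
  using (Subset; inside; outside; _∉_; ∣_∣; ⊥; ⁅_⁆; _∪_; _⊆_)
open import Data.Fin.Subset.Properties
  using ( _∈?_; ∉⊥; ∣⊥∣≡0; nonempty?; Empty-unique; x∈⁅x⁆; x∈⁅y⁆⇒x≡y; x∈p∪q⁻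
        ; p⊆p∪q; q⊆p∪q; p⊂q⇒∣p∣<∣q∣)
open import Data.Nat.Base using (ℕ; zero; suc; _≤_; _<_; s≤s; parity)
import Data.Nat.Properties as ℕ
-- Data.Parity.Base gives _+_ and _*_ the same precedence.
open import Data.Parity.Base using (0ℙ; 1ℙ; _*_) renaming (_+_ to infixl 6 _+_)
import Data.Parity.Properties as ℙ
open import Data.Product.Base using (Σ; ∃; _×_; _,_; proj₁; proj₂; map₂)
open import Data.Sum.Base using ([_,_]′)
open import Data.Vec.Base using (Vec; []; _∷_; _[_]≔_; lookup; tabulate; here; there)
open import Data.Vec.Properties using (lookup∘tabulate; lookup⇒[]=; []=⇒lookup)
open import Function.Base using (_∘_)
open import Function.Bundles using (mk⇔; Equivalence)
open import Relation.Binary.PropositionalEquality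
  using (_≡_; _≢_; _≗_; refl; sym; trans; cong; cong₂; module ≡-Reasoning)
open import Relation.Nullary using (¬_; Dec; yes; no; does; contradiction)
open import Relation.Nullary.Decidable using (map′; ¬?; _×-dec_; _→-dec_; dec-true; dec-false)
open import Relation.Unary using (_≐_)

open SemiringSum (CommutativeRing.semiring ℙ.+-*-commutativeRing)
  using (sum; sum-cong-≗; ∑-distrib-+; *-distribˡ-sum; sum-replicate-zero)
-- The coefficients of this solver lie in 𝔽₂, so it also proves x + x = 0.
open RingSolver (ACR.fromCommutativeRing ℙ.+-*-commutativeRing) ℙ._≟_
  using (solve; _:=_; _:+_; _:*_; con)

private variable
  k n : ℕ

-- Vectors and dot products over the two-element field

≢1⇒≡0 : ∀ {x} → x ≢ 1ℙ → x ≡ 0ℙ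
≢1⇒≡0 {0ℙ} _   = refl
≢1⇒≡0 {1ℙ} 1≢1 = contradiction refl 1≢1

≢0⇒≡1 : ∀ {x} → x ≢ 0ℙ → x ≡ 1ℙ
≢0⇒≡1 {0ℙ} 0≢0 = contradiction refl 0≢0
≢0⇒≡1 {1ℙ} _   = refl

+≡0⇒≡ : ∀ {x y} → x + y ≡ 0ℙ → x ≡ y
+≡0⇒≡ {0ℙ} {0ℙ} _ = refl
+≡0⇒≡ {1ℙ} {1ℙ} _ = refl

Vector : ℕ → Set
Vector n = Fin n → 𝔽₂

FunMatrix : ℕ → Set
FunMatrix n = Fin n → Vector n

private variable
  m m′ : FunMatrix n

dot : Vector n → Vector n → 𝔽₂
dot c x = sum λ v → c v * x v

dot-cong : ∀ {c d x y : Vector n} → c ≗ d → x ≗ y → dot c x ≡ dot d y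
dot-cong c≗d x≗y = sum-cong-≗ λ v → cong₂ _*_ (c≗d v) (x≗y v)

dot-comm : ∀ (c x : Vector n) → dot c x ≡ dot x c
dot-comm c x = sum-cong-≗ λ v → ℙ.*-comm (c v) (x v)

dot-zeroˡ : ∀ {c} (x : Vector n) → (∀ v → c v ≡ 0ℙ) → dot c x ≡ 0ℙ
dot-zeroˡ {n} x c≡0 =
  trans (sum-cong-≗ λ v → cong (_* x v) (c≡0 v)) (sum-replicate-zero n)

dot-linearʳ : ∀ (c x : Vector n) a y →
              dot c (λ v → x v + a * y v) ≡ dot c x + a * dot c y
dot-linearʳ c x a y = begin
  dot c (λ v → x v + a * y v)
    ≡⟨ sum-cong-≗ (λ v → solve 4 (λ c x a y → c :* (x :+ a :* y) := c :* x :+ a :* (c :* y))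
                               refl (c v) (x v) a (y v)) ⟩
  sum (λ v → c v * x v + a * (c v * y v))
    ≡⟨ ∑-distrib-+ (λ v → c v * x v) (λ v → a * (c v * y v)) ⟩
  dot c x + sum (λ v → a * (c v * y v))
    ≡⟨ cong (dot c x +_) (*-distribˡ-sum a (λ v → c v * y v)) ⟨
  dot c x + a * dot c y ∎
  where open ≡-Reasoning

dot-linearˡ : ∀ (c : Vector n) a d x →
              dot (λ v → c v + a * d v) x ≡ dot c x + a * dot d x
dot-linearˡ c a d x = begin
  dot (λ v → c v + a * d v) x ≡⟨ dot-comm _ x ⟩
  dot x (λ v → c v + a * d v) ≡⟨ dot-linearʳ x c a d ⟩
  dot x c + a * dot x d       ≡⟨ cong₂ (λ s t → s + a * t) (dot-comm x c) (dot-comm x d) ⟩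
  dot c x + a * dot d x       ∎
  where open ≡-Reasoning

δ : Fin n → Vector n
δ zero    zero    = 1ℙ
δ zero    (suc _) = 0ℙ
δ (suc _) zero    = 0ℙ
δ (suc i) (suc j) = δ i j

δ-diagonal : ∀ (j : Fin n) → δ j j ≡ 1ℙ
δ-diagonal zero    = refl
δ-diagonal (suc j) = δ-diagonal j

δ-≢ : ∀ {i j : Fin n} → i ≢ j → δ i j ≡ 0ℙ
δ-≢ {i = zero}  {zero}  i≢j = contradiction refl i≢j
δ-≢ {i = zero}  {suc j} i≢j = refl
δ-≢ {i = suc i} {zero}  i≢j = refl
δ-≢ {i = suc i} {suc j} i≢j = δ-≢ (i≢j ∘ cong suc)

dot-δ : ∀ (j : Fin n) x → dot (δ j) x ≡ x j
dot-δ zero x = trans (cong (x zero +_) (dot-zeroˡ (x ∘ suc) λ _ → refl))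
                     (ℙ.+-identityʳ (x zero))
dot-δ (suc j) x = dot-δ j (x ∘ suc)

-- Kernels and rank bounds

-- These are the linear dependencies among the columns of `m` indexed by `S`.
Kernel : FunMatrix n → Subset n → Vector n → Set
Kernel m S c = (∀ j → j ∉ S → c j ≡ 0ℙ) × (∀ i → dot c (m i) ≡ 0ℙ)

Independent : FunMatrix n → Subset n → Set
Independent m S = ∀ c → Kernel m S c → ∀ j → c j ≡ 0ℙ

-- Only upper bounds on rank enter the argument, so bounding all independent column sets replaces
-- the construction of bases.
RankAtMost : FunMatrix n → ℕ → Set
RankAtMost m k = ∀ S → Independent m S → ∣ S ∣ ≤ k

kernel-congᵛ : ∀ {S} {c d : Vector n} → c ≗ d → Kernel m S c → Kernel m S d
kernel-congᵛ c≗d (supp , ker) =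
  (λ j j∉S → trans (sym (c≗d j)) (supp j j∉S)) ,
  (λ i → trans (dot-cong (sym ∘ c≗d) λ _ → refl) (ker i))

kernel-congᵐ : ∀ {S} {c : Vector n} → (∀ u v → m u v ≡ m′ u v) →
               Kernel m S c → Kernel m′ S c
kernel-congᵐ m≗m′ (supp , ker) =
  supp , λ i → trans (dot-cong (λ _ → refl) (sym ∘ m≗m′ i)) (ker i)

kernel-linear : ∀ {S} {c d : Vector n} a → Kernel m S c → Kernel m S d →
                Kernel m S (λ v → c v + a * d v)
kernel-linear {m = m} {c = c} {d} a (supp-c , ker-c) (supp-d , ker-d) =
  (λ j j∉S → zeros (supp-c j j∉S) (supp-d j j∉S)) ,
  (λ i → trans (dot-linearˡ c a d (m i)) (zeros (ker-c i) (ker-d i)))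
  where
  zeros : ∀ {x y} → x ≡ 0ℙ → y ≡ 0ℙ → x + a * y ≡ 0ℙ
  zeros refl refl = ℙ.*-zeroʳ a

rank-cong : (∀ u v → m u v ≡ m′ u v) → RankAtMost m k → RankAtMost m′ k
rank-cong m≗m′ bound S ind =
  bound S λ c → ind c ∘ kernel-congᵐ m≗m′

zero-column∉ : ∀ {S} {j : Fin n} → (∀ u → m u j ≡ 0ℙ) → Independent m S → j ∉ S
zero-column∉ {m = m} {S} {j} mj≡0 ind j∈S =
  contradiction (trans (sym (δ-diagonal j)) (ind (δ j) (supp , ker) j)) λ ()
  where
  supp : ∀ v → v ∉ S → δ j v ≡ 0ℙ
  supp v v∉S = δ-≢ {i = j} {v} λ { refl → v∉S j∈S }

  ker : ∀ u → dot (δ j) (m u) ≡ 0ℙ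
  ker u = trans (dot-δ j (m u)) (mj≡0 u)

rank-zero : (∀ (u v : Fin n) → m u v ≡ 0ℙ) → RankAtMost m 0
rank-zero {n} m≡0 S ind with nonempty? S
... | yes (j , j∈S) = contradiction j∈S (zero-column∉ (λ u → m≡0 u j) ind)
... | no  empty rewrite Empty-unique empty = ℕ.≤-reflexive (∣⊥∣≡0 n)

-- Gaussian elimination at an entry `m i j` equal to 1: multiples of row `i` clear column `j`.
-- Addition serves as subtraction in characteristic 2.
pivot : FunMatrix n → Fin n → Fin n → FunMatrix n
pivot m i j u v = m u v + m u j * m i v

module _ {i j : Fin n} (mij≡1 : m i j ≡ 1ℙ) where

  pivot-column : ∀ u → pivot m i j u j ≡ 0ℙ
  pivot-column u rewrite mij≡1 =
    solve 1 (λ x → x :+ x :* con 1ℙ := con 0ℙ) refl (m u j)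

  -- Row operations keep `c` in the kernel, and column `j` of the pivoted matrix is zero, so erasing
  -- coordinate `j` of `c` leaves a dependency on `S`, hence zero. Thus `c` is a multiple of `δ j`,
  -- and row `i` of `m` forces the factor to vanish.
  pivot-independent : ∀ {S} → Independent (pivot m i j) S → Independent m (S ∪ ⁅ j ⁆)
  pivot-independent {S} ind c (supp , ker) v = trans (c≡cⱼδ v) (cong (_* δ j v) cⱼ≡0)
    where
    open ≡-Reasoning

    c⁻ : Vector n
    c⁻ v = c v + c j * δ j v

    supp⁻ : ∀ v → v ∉ S → c⁻ v ≡ 0ℙ
    supp⁻ v v∉S with v Fin.≟ j
    ... | yes refl rewrite δ-diagonal v =
      solve 1 (λ x → x :+ x :* con 1ℙ := con 0ℙ) refl (c v)
    ... | no v≢j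
      rewrite δ-≢ (v≢j ∘ sym)
            | supp v ([ v∉S , v≢j ∘ x∈⁅y⁆⇒x≡y j ]′ ∘ x∈p∪q⁻ S ⁅ j ⁆) = ℙ.*-zeroʳ (c j)

    ker⁻ : ∀ u → dot c⁻ (pivot m i j u) ≡ 0ℙ
    ker⁻ u = begin
      dot c⁻ (pivot m i j u)
        ≡⟨ dot-linearˡ c (c j) (δ j) (pivot m i j u) ⟩
      dot c (pivot m i j u) + c j * dot (δ j) (pivot m i j u)
        ≡⟨ cong₂ (λ s t → s + c j * t) (dot-linearʳ c (m u) (m u j) (m i))
                 (trans (dot-δ j (pivot m i j u)) (pivot-column u)) ⟩
      (dot c (m u) + m u j * dot c (m i)) + c j * 0ℙ
        ≡⟨ cong₂ (λ s t → (s + m u j * t) + c j * 0ℙ) (ker u) (ker i) ⟩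
      m u j * 0ℙ + c j * 0ℙ
        ≡⟨ cong₂ _+_ (ℙ.*-zeroʳ (m u j)) (ℙ.*-zeroʳ (c j)) ⟩
      0ℙ ∎

    c≡cⱼδ : ∀ v → c v ≡ c j * δ j v
    c≡cⱼδ v = +≡0⇒≡ (ind c⁻ (supp⁻ , ker⁻) v)

    cⱼ≡0 : c j ≡ 0ℙ
    cⱼ≡0 = begin
      c j                                  ≡⟨ ℙ.*-identityʳ (c j) ⟨
      c j * 1ℙ                             ≡⟨ cong (c j *_) (trans (dot-δ j (m i)) mij≡1) ⟨
      c j * dot (δ j) (m i)                ≡⟨ cong (_+ c j * dot (δ j) (m i)) (dot-zeroˡ {c = λ _ → 0ℙ} (m i) λ _ → refl) ⟨
      dot (λ _ → 0ℙ) (m i) + c j * dot (δ j) (m i)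
                                           ≡⟨ dot-linearˡ (λ _ → 0ℙ) (c j) (δ j) (m i) ⟨
      dot (λ v → c j * δ j v) (m i)        ≡⟨ dot-cong c≡cⱼδ (λ _ → refl) ⟨
      dot c (m i)                          ≡⟨ ker i ⟩
      0ℙ                                   ∎

  -- The zero column `j` cannot lie in `S`, so adjoining `j` gives a strictly larger set that is
  -- independent for `m`.
  pivot-< : RankAtMost m k → ∀ S → Independent (pivot m i j) S → ∣ S ∣ < k
  pivot-< bound S ind = ℕ.<-≤-trans
    (p⊂q⇒∣p∣<∣q∣ (p⊆p∪q ⁅ j ⁆ , j , q⊆p∪q S ⁅ j ⁆ (x∈⁅x⁆ j) , zero-column∉ pivot-column ind))
    (bound (S ∪ ⁅ j ⁆) (pivot-independent ind))

  rank-pivot : RankAtMost m (suc k) → RankAtMost (pivot m i j) k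
  rank-pivot bound S = ℕ.≤-pred ∘ pivot-< bound S

  rank-positive : ¬ RankAtMost m 0
  rank-positive bound with () ← pivot-< bound ⊥ (λ c (supp , _) v → supp v ∉⊥)

-- Rank-one updates

∣p∣≤1+∣p[x]≔outside∣ : ∀ (p : Subset n) x → ∣ p ∣ ≤ suc ∣ p [ x ]≔ outside ∣
∣p∣≤1+∣p[x]≔outside∣ (inside  ∷ p) zero    = ℕ.≤-refl
∣p∣≤1+∣p[x]≔outside∣ (outside ∷ p) zero    = ℕ.n≤1+n ∣ p ∣
∣p∣≤1+∣p[x]≔outside∣ (inside  ∷ p) (suc x) = s≤s (∣p∣≤1+∣p[x]≔outside∣ p x)
∣p∣≤1+∣p[x]≔outside∣ (outside ∷ p) (suc x) = ∣p∣≤1+∣p[x]≔outside∣ p x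

x∉p[x]≔outside : ∀ (p : Subset n) x → x ∉ p [ x ]≔ outside
x∉p[x]≔outside (_ ∷ p) (suc x) (there x∈) = x∉p[x]≔outside p x x∈

p[x]≔outside⊆p : ∀ (p : Subset n) x → p [ x ]≔ outside ⊆ p
p[x]≔outside⊆p (_ ∷ p) zero    (there v∈) = there v∈
p[x]≔outside⊆p (_ ∷ p) (suc x) here       = here
p[x]≔outside⊆p (_ ∷ p) (suc x) (there v∈) = there (p[x]≔outside⊆p p x v∈)

module _ (m : FunMatrix n) (S : Subset n) (b : Vector n) where

  Unorthogonal : Vector n → Set
  Unorthogonal c = Kernel m S c × dot c b ≡ 1ℙ

  unorthogonal? : Dec (∃ Unorthogonal)
  unorthogonal? = map′
    (λ (c , p) → lookup c , p)
    (λ (c , ker , c·b≡1) → tabulate c , kernel-congᵛ (sym ∘ lookup∘tabulate c) ker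
      , trans (dot-cong (lookup∘tabulate c) λ _ → refl) c·b≡1)
    (searchVec search𝔽₂ n λ c →
      ((Fin.all? λ j → ¬? (j ∈? S) →-dec (lookup c j ℙ.≟ 0ℙ)) ×-dec
       (Fin.all? λ i → dot (lookup c) (m i) ℙ.≟ 0ℙ)) ×-dec
      (dot (lookup c) b ℙ.≟ 1ℙ))

-- If all dependencies of `m` on `S` are orthogonal to `b`, the update does not affect them and `S`
-- is independent for `m` itself. Otherwise take a dependency `c` with `dot c b` equal to 1;
-- deleting from `S` one index where `c` is nonzero makes it independent for `m`.
rank-update : ∀ {m : FunMatrix n} (a b : Vector n) → RankAtMost m k →
              RankAtMost (λ u v → m u v + a u * b v) (suc k)
rank-update {n} {k} {m} a b bound S ind with unorthogonal? m S b
... | no orthogonal = ℕ.m≤n⇒m≤1+n (bound S λ c (supp , ker) → ind c (supp , λ u → begin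
    dot c (λ v → m u v + a u * b v) ≡⟨ dot-linearʳ c (m u) (a u) b ⟩
    dot c (m u) + a u * dot c b     ≡⟨ cong₂ (λ s t → s + a u * t) (ker u)
                                        (≢1⇒≡0 λ c·b≡1 → orthogonal (c , (supp , ker) , c·b≡1)) ⟩
    a u * 0ℙ                        ≡⟨ ℙ.*-zeroʳ (a u) ⟩
    0ℙ                              ∎))
  where open ≡-Reasoning
... | yes (c , ker-c , c·b≡1) with Fin.any? (λ i → c i ℙ.≟ 1ℙ)
...   | no c≢1 = contradiction
          (trans (sym c·b≡1) (dot-zeroˡ b λ i → ≢1⇒≡0 λ ci≡1 → c≢1 (i , ci≡1))) λ ()
...   | yes (i , ci≡1) = ℕ.≤-trans (∣p∣≤1+∣p[x]≔outside∣ S i) (s≤s (bound (S [ i ]≔ outside) ind⁻))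
  where
  open ≡-Reasoning

  ind⁻ : Independent m (S [ i ]≔ outside)
  ind⁻ d (supp-d , ker-d) v = begin
    d v           ≡⟨ ℙ.+-identityʳ (d v) ⟨
    d v + 0ℙ      ≡⟨ cong (λ s → d v + s * c v) t≡0 ⟨
    e v           ≡⟨ e≡0 v ⟩
    0ℙ            ∎
    where
    t : 𝔽₂
    t = dot d b

    -- The multiple of `c` is chosen to make `e` orthogonal to `b`, so that `e` is a dependency of
    -- the updated matrix too.
    e : Vector n
    e v = d v + t * c v

    ker-e : Kernel m S e
    ker-e = kernel-linear t ((λ j j∉S → supp-d j (j∉S ∘ p[x]≔outside⊆p S i)) , ker-d) ker-c

    e·b≡0 : dot e b ≡ 0ℙ
    e·b≡0 = begin
      dot e b          ≡⟨ dot-linearˡ d t c b ⟩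
      t + t * dot c b  ≡⟨ cong (λ s → t + t * s) c·b≡1 ⟩
      t + t * 1ℙ       ≡⟨ solve 1 (λ t → t :+ t :* con 1ℙ := con 0ℙ) refl t ⟩
      0ℙ               ∎

    e≡0 : ∀ v → e v ≡ 0ℙ
    e≡0 = ind e (proj₁ ker-e , λ u → begin
      dot e (λ v → m u v + a u * b v) ≡⟨ dot-linearʳ e (m u) (a u) b ⟩
      dot e (m u) + a u * dot e b     ≡⟨ cong₂ (λ s t → s + a u * t) (proj₂ ker-e u) e·b≡0 ⟩
      a u * 0ℙ                        ≡⟨ ℙ.*-zeroʳ (a u) ⟩
      0ℙ                              ∎)

    -- At the deleted index `i`, `d` vanishes and `c` is 1, so `e i` is `t`.
    t≡0 : t ≡ 0ℙ
    t≡0 = begin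
      t               ≡⟨ ℙ.*-identityʳ t ⟨
      t * 1ℙ          ≡⟨ cong₂ (λ x y → x + t * y) (supp-d i (x∉p[x]≔outside S i)) ci≡1 ⟨
      e i             ≡⟨ e≡0 i ⟩
      0ℙ              ∎

-- Subset systems as sums of squares

χ : Subset n → Vector n
χ S u with u ∈? S
... | yes _ = 1ℙ
... | no  _ = 0ℙ

support : Vector n → Subset n
support a = tabulate λ u → does (a u ℙ.≟ 1ℙ)

χ-support : ∀ (a : Vector n) u → χ (support a) u ≡ a u
χ-support a u with u ∈? support a | a u ℙ.≟ 1ℙ
... | yes _  | yes au≡1 = sym au≡1
... | no  _  | no  au≢1 = sym (≢1⇒≡0 au≢1)
... | yes u∈ | no  au≢1 = contradiction
  (trans (sym ([]=⇒lookup u∈)) (trans (lookup∘tabulate _ u) (dec-false (a u ℙ.≟ 1ℙ) au≢1))) λ ()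
... | no  u∉ | yes au≡1 = contradiction
  (lookup⇒[]= u (support a) (trans (lookup∘tabulate _ u) (dec-true (a u ℙ.≟ 1ℙ) au≡1))) u∉

-- This is the vertex-by-set incidence matrix times its transpose. Its diagonal records how often
-- each vertex is covered, which is harmless because `Fits` leaves the diagonal free.
gram : Vec (Subset n) k → FunMatrix n
gram 𝒞 u v = parity (timesTogether 𝒞 u v)

parity-suc : ∀ k → parity (suc k) ≡ 1ℙ + parity k
parity-suc zero          = refl
parity-suc (suc zero)    = refl
parity-suc (suc (suc k)) = parity-suc k

gram-∷ : ∀ S (𝒞 : Vec (Subset n) k) u v → gram (S ∷ 𝒞) u v ≡ gram 𝒞 u v + χ S u * χ S v
gram-∷ S 𝒞 u v with u ∈? S | v ∈? S
... | yes _ | yes _ = trans (parity-suc (timesTogether 𝒞 u v)) (ℙ.+-comm 1ℙ (gram 𝒞 u v))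
... | yes _ | no  _ = sym (ℙ.+-identityʳ _)
... | no  _ | yes _ = sym (ℙ.+-identityʳ _)
... | no  _ | no  _ = sym (ℙ.+-identityʳ _)

gram-support : ∀ (a : Vector n) (𝒞 : Vec (Subset n) k) u v →
               gram (support a ∷ 𝒞) u v ≡ gram 𝒞 u v + a u * a v
gram-support a 𝒞 u v = trans (gram-∷ (support a) 𝒞 u v)
  (cong₂ (λ x y → gram 𝒞 u v + x * y) (χ-support a u) (χ-support a v))

gram-sym : ∀ (𝒞 : Vec (Subset n) k) u v → gram 𝒞 u v ≡ gram 𝒞 v u
gram-sym []      u v = refl
gram-sym (S ∷ 𝒞) u v = begin
  gram (S ∷ 𝒞) u v           ≡⟨ gram-∷ S 𝒞 u v ⟩
  gram 𝒞 u v + χ S u * χ S v ≡⟨ cong₂ _+_ (gram-sym 𝒞 u v) (ℙ.*-comm (χ S u) (χ S v)) ⟩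
  gram 𝒞 v u + χ S v * χ S u ≡⟨ gram-∷ S 𝒞 v u ⟨
  gram (S ∷ 𝒞) v u           ∎
  where open ≡-Reasoning

gram-rank : (𝒞 : Vec (Subset n) k) → RankAtMost (gram 𝒞) k
gram-rank []      = rank-zero λ _ _ → refl
gram-rank (S ∷ 𝒞) = rank-cong (λ u v → sym (gram-∷ S 𝒞 u v))
                              (rank-update (χ S) (χ S) (gram-rank 𝒞))

SumOfSquares : FunMatrix n → ℕ → Set
SumOfSquares {n} m k = Σ (Vec (Subset n) k) λ 𝒞 → ∀ u v → gram 𝒞 u v ≡ m u v

squares-cong : (∀ u v → m u v ≡ m′ u v) → SumOfSquares m k → SumOfSquares m′ k
squares-cong m≗m′ = map₂ λ gram≗m u v → trans (gram≗m u v) (m≗m′ u v)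

add-square : ∀ (a : Vector n) → SumOfSquares m k →
             SumOfSquares (λ u v → m u v + a u * a v) (suc k)
add-square a (𝒞 , gram≗m) = support a ∷ 𝒞 , λ u v →
  trans (gram-support a 𝒞 u v) (cong (_+ a u * a v) (gram≗m u v))

-- Empty sets pad the family to exactly `k` members.
zero-squares : ∀ k → (∀ (u v : Fin n) → m u v ≡ 0ℙ) → SumOfSquares m k
zero-squares zero    m≡0 = [] , λ u v → sym (m≡0 u v)
zero-squares (suc k) m≡0 = squares-cong (λ u v → ℙ.+-identityʳ _)
  (add-square (λ _ → 0ℙ) (zero-squares k m≡0))

-- The first set `S` supplies the vector `c` of the three-square identity and is used up, so one set
-- becomes three.
add-hyperbolic : ∀ (a b : Vector n) → SumOfSquares m (suc k) →
                 SumOfSquares (λ u v → m u v + (a u * b v + b u * a v)) (suc (suc (suc k)))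
add-hyperbolic {m = m} a b (S ∷ 𝒞 , gram≗m) =
  squares-cong eq
    (add-square (λ u → a u + χ S u) (add-square (λ u → b u + χ S u)
      (add-square (λ u → (a u + b u) + χ S u) (𝒞 , λ _ _ → refl))))
  where
  eq : ∀ u v → _
  eq u v = trans
    (solve 7 (λ g a b c a′ b′ c′ →
        g :+ ((a :+ b) :+ c) :* ((a′ :+ b′) :+ c′) :+ (b :+ c) :* (b′ :+ c′)
          :+ (a :+ c) :* (a′ :+ c′)
        := (g :+ c :* c′) :+ (a :* b′ :+ b :* a′))
      refl (gram 𝒞 u v) (a u) (b u) (χ S u) (a v) (b v) (χ S v))
    (cong (_+ (a u * b v + b u * a v)) (trans (sym (gram-∷ S 𝒞 u v)) (gram≗m u v)))

-- Symmetric elimination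

-- The index is a budget, which `trivial` may leave partly unspent: a square costs one, a hyperbolic
-- term two. Each constructor decomposes what remains after its term is subtracted.
data Decomposition {n} (m : FunMatrix n) : ℕ → Set where
  trivial    : (∀ u v → m u v ≡ 0ℙ) → Decomposition m k
  square     : ∀ (a : Vector n) → Decomposition (λ u v → m u v + a u * a v) k →
               Decomposition m (suc k)
  hyperbolic : ∀ (a b : Vector n) → Decomposition (λ u v → m u v + (a u * b v + b u * a v)) k →
               Decomposition m (suc (suc k))

-- A nonzero diagonal entry is a pivot that splits off a square. If the diagonal is zero, a nonzero
-- entry at `(i , j)` and its mirror image are pivoted in turn, splitting off a hyperbolic term.
decompose : ∀ k (m : FunMatrix n) → (∀ u v → m u v ≡ m v u) → RankAtMost m k →
            Decomposition m k
decompose k m m-sym bound with Fin.any? (λ i → m i i ℙ.≟ 1ℙ)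
decompose zero    m m-sym bound | yes (i , mii≡1) = contradiction bound (rank-positive mii≡1)
decompose (suc k) m m-sym bound | yes (i , mii≡1) =
  square a (decompose k _
    (λ u v → cong₂ _+_ (m-sym u v) (ℙ.*-comm (a u) (a v)))
    (rank-cong (λ u v → cong (λ x → m u v + m u i * x) (m-sym i v)) (rank-pivot mii≡1 bound)))
  where
  a : Vector _
  a u = m u i
decompose k m m-sym bound | no alternating with Fin.any? (λ i → Fin.any? λ j → m i j ℙ.≟ 1ℙ)
... | no m≢1 = trivial λ u v → ≢1⇒≡0 λ muv≡1 → m≢1 (u , v , muv≡1)
... | yes (i , j , mij≡1) = eliminate k bound
  where
  open ≡-Reasoning

  a b : Vector _
  a u = m u i
  b u = m u j

  diagonal : ∀ u → m u u ≡ 0ℙ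
  diagonal u = ≢1⇒≡0 λ muu≡1 → alternating (u , muu≡1)

  -- The zero diagonal keeps the mirror entry intact under the first pivot, so a second pivot is
  -- possible.
  pivot-ji : pivot m i j j i ≡ 1ℙ
  pivot-ji = begin
    m j i + m j j * m i i  ≡⟨ cong₂ (λ x y → x + y * m i i) (trans (m-sym j i) mij≡1) (diagonal j) ⟩
    1ℙ                     ∎

  -- The two pivots together subtract a symmetric matrix, so symmetry is available again for the
  -- recursion.
  pivot² : ∀ u v → pivot (pivot m i j) j i u v ≡ m u v + (a u * b v + b u * a v)
  pivot² u v = begin
    (m u v + m u j * m i v) + (m u i + m u j * m i i) * (m j v + m j j * m i v)
      ≡⟨ cong₂ (λ x y → (m u v + m u j * m i v) + (m u i + m u j * x) * (m j v + y * m i v))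
               (diagonal i) (diagonal j) ⟩
    (m u v + m u j * m i v) + (m u i + m u j * 0ℙ) * (m j v + 0ℙ)
      ≡⟨ solve 5 (λ x p q r s → (x :+ p :* q) :+ (r :+ p :* con 0ℙ) :* (s :+ con 0ℙ)
                               := x :+ (r :* s :+ p :* q))
           refl (m u v) (m u j) (m i v) (m u i) (m j v) ⟩
    m u v + (m u i * m j v + m u j * m i v)
      ≡⟨ cong₂ (λ x y → m u v + (m u i * x + m u j * y)) (m-sym j v) (m-sym i v) ⟩
    m u v + (a u * b v + b u * a v) ∎

  eliminate : ∀ k → RankAtMost m k → Decomposition m k
  -- Since two successive pivots exist, rank bounds 0 and 1 are impossible.
  eliminate zero          bound = contradiction bound (rank-positive mij≡1)
  eliminate (suc zero)    bound =
    contradiction (rank-pivot mij≡1 bound) (rank-positive pivot-ji)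
  eliminate (suc (suc k)) bound = hyperbolic a b (decompose k _
    (λ u v → cong₂ _+_ (m-sym u v)
      (solve 4 (λ a b a′ b′ → a :* b′ :+ b :* a′ := a′ :* b :+ b′ :* a)
             refl (a u) (b u) (a v) (b v)))
    (rank-cong pivot² (rank-pivot pivot-ji (rank-pivot mij≡1 bound))))

-- From decompositions to sums of squares

cancel-square : ∀ (x y : 𝔽₂) → (x + y) + y ≡ x
cancel-square = solve 2 (λ x y → (x :+ y) :+ y := x) refl

-- The extra square keeps the family nonempty at every stage, so each hyperbolic term finds a set to
-- absorb it and every term costs exactly its budget.
squares-with-extra : ∀ (c : Vector n) → Decomposition m k →
                     SumOfSquares (λ u v → m u v + c u * c v) (suc k)
squares-with-extra c (trivial {k = k} m≡0) = add-square c (zero-squares k m≡0)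
squares-with-extra {m = m} c (square a D) = squares-cong
  (λ u v → solve 3 (λ x s t → ((x :+ s) :+ t) :+ s := x :+ t)
           refl (m u v) (a u * a v) (c u * c v))
  (add-square a (squares-with-extra c D))
squares-with-extra {m = m} c (hyperbolic a b D) = squares-cong
  (λ u v → solve 3 (λ x s t → ((x :+ s) :+ t) :+ s := x :+ t)
           refl (m u v) (a u * b v + b u * a v) (c u * c v))
  (add-hyperbolic a b (squares-with-extra c D))

squares-of-odd : Odd k → Decomposition m k → SumOfSquares m k
squares-of-odd {k} odd (trivial m≡0) = zero-squares k m≡0
squares-of-odd {m = m} odd (square a D) =
  -- The square just split off serves as the extra one: adding it to the remainder restores `m`.
  squares-cong (λ u v → cancel-square (m u v) (a u * a v)) (squares-with-extra a D)
-- Parity rules out a budget of 2, so the remaining budget `suc k` is odd and positive and its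
-- family has a set to spare.
squares-of-odd {suc (suc (suc k))} {m = m} odd (hyperbolic a b D) =
  squares-cong (λ u v → cancel-square (m u v) (a u * b v + b u * a v))
    (add-hyperbolic a b (squares-of-odd odd D))

-- Minimum rank and subgraph complementation number

module _ {n k : ℕ} (M : Matrix n n) where

  rank≤⇒RankAtMost : rank M ≤ k → RankAtMost (entry M) k
  rank≤⇒RankAtMost r≤k S ind = ℕ.≤-trans
    (proj₂ (proj₂ (rank-greatest M)) ∣ S ∣
      (S , refl , λ c supp ker → ind (lookup c) (supp , ker)))
    r≤k

  RankAtMost⇒rank≤ : RankAtMost (entry M) k → rank M ≤ k
  RankAtMost⇒rank≤ bound with rank-greatest M
  ... | _ , (S , refl , ind) , _ = bound S λ c ker v →
    let supp′ , ker′ = kernel-congᵛ {m = entry M} (sym ∘ lookup∘tabulate c) ker in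
    trans (sym (lookup∘tabulate c v)) (ind (tabulate c) supp′ ker′ v)

module _ (G : Graph) where
  open Graph G using (order)

  system⇒c₂≤ : HasSystemOfSize G k → c₂ G ≤ k
  system⇒c₂≤ = proj₂ (proj₂ (c₂-least G)) _

  -- The Gram matrix of a smallest system fits the graph, with rank at most the number of sets.
  c₂≤⇒mr≤ : c₂ G ≤ k → mr𝔽₂ G ≤ k
  c₂≤⇒mr≤ c₂≤k with _ , (𝒞 , sys) , _ ← c₂-least G = ℕ.≤-trans
    (ℕ.≤-trans (proj₂ (proj₂ (mr𝔽₂-least G)) (rank M) (M , (symmetric , fits) , refl))
               (RankAtMost⇒rank≤ M (rank-cong (λ u v → sym (M≗gram u v)) (gram-rank 𝒞))))
    c₂≤k
    where
    M : Matrix order order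
    M = tabulate λ u → tabulate (gram 𝒞 u)

    M≗gram : ∀ u v → entry M u v ≡ gram 𝒞 u v
    M≗gram u v = trans (cong (λ row → lookup row v) (lookup∘tabulate (λ u → tabulate (gram 𝒞 u)) u))
                       (lookup∘tabulate (gram 𝒞 u) v)

    symmetric : IsSymmetric M
    symmetric u v = trans (M≗gram u v) (trans (gram-sym 𝒞 u v) (sym (M≗gram v u)))

    fits : ∀ u v → u ≢ v → _
    fits u v u≢v = mk⇔
      (λ Muv≢0 → from (≢0⇒≡1 (Muv≢0 ∘ trans (M≗gram u v))))
      (λ u~v Muv≡0 → contradiction (trans (sym (to u~v)) (trans (sym (M≗gram u v)) Muv≡0)) λ ())
      where open Equivalence (sys u v u≢v)

  mr≤⇒c₂≤ : Odd k → mr𝔽₂ G ≤ k → c₂ G ≤ k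
  mr≤⇒c₂≤ {k} odd mr≤k with mr𝔽₂-least G
  ... | _ , (M , (symmetric , fits) , refl) , _
    with 𝒞 , gram≗M ← squares-of-odd odd
           -- The budget is the odd `k` rather than the rank of `M`, which may be even.
           (decompose k (entry M) symmetric (rank≤⇒RankAtMost M mr≤k)) =
    system⇒c₂≤ (𝒞 , λ u v u≢v → let open Equivalence (fits u v u≢v) in mk⇔
      (λ u~v → trans (gram≗M u v) (≢0⇒≡1 (from u~v)))
      (λ gram≡1 → to λ Muv≡0 →
        contradiction (trans (sym gram≡1) (trans (gram≗M u v) Muv≡0)) λ ()))

proposition5p1 : (k : ℕ) → Odd k →
    (λ (G : Graph) → c₂ G ≤ k) ≐ (λ (G : Graph) → mr𝔽₂ G ≤ k)
proposition5p1 k odd = (λ {G} → c₂≤⇒mr≤ G) , (λ {G} → mr≤⇒c₂≤ G odd)
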